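{- Let $n\geq 4$ and let $f:\{0,1\}^n\to\{0,1\}$ be a Boolean function depending essentially on all of its $n$ variables. Then $f$ has essential arity gap $2$, i.e. $gap(f)=2$, if and only if $$f=\bigoplus_{\alpha_1\ldots\alpha_n\in Od_2^n}x_1^{\alpha_1}\cdots x_n^{\alpha_n}\quad\text{or}\quad f=\bigoplus_{\alpha_1\ldots\alpha_n\in Ev_2^n}x_1^{\alpha_1}\cdots x_n^{\alpha_n}.$$
   Context: $B=\{0,1\}$ is the ring of residues modulo $2$, with addition $\oplus$ and multiplication modulo $2$. $P_2^n$ is the set of all functions $f:B^n\to B$, with variables $x_1,\ldots,x_n$. For $\alpha\in B$, $x^\alpha=1$ if $x=\alpha$ and $x^\alpha=0$ otherwise. A variable $x_i$ is essential in $f$ if changing the $i$-th argument alone changes the value of $f$ at some point; $Ess(f)$ is the set of essential variables and $ess(f)=|Ess(f)|$. For $i\neq j$, the identification minor $f_{i\leftarrow j}$ is the function obtained from $f$ by substituting $x_j$ for $x_i$ (regarded as a function of $x_1,\ldots,x_n$). The essential arity gap is $gap(f)=ess(f)-\max ess(f_{i\leftarrow j})$, the maximum being over all pairs of distinct essential variables $x_i,x_j$ of $f$. $Od_2^n=\{\alpha_1\ldots\alpha_n\in\{0,1\}^n:\alpha_1\oplus\cdots\oplus\alpha_n=1\}$ and $Ev_2^n=\{\alpha_1\ldots\alpha_n\in\{0,1\}^n:\alpha_1\oplus\cdots\oplus\alpha_n=0\}$. -}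

module Defs where

open import Data.Bool using (Bool; true; false; not; _∧_; _xor_; _≟_)
open import Data.Fin using (Fin)
import Data.Fin as Fin
open import Data.Fin.Subset using (Subset; _∈_; ∣_∣)
open import Data.Fin.Subset.Properties using (_∈?_; anySubset?)
open import Data.List using (List; filter; foldr; map; allFin; cartesianProduct; cartesianProductWith)
import Data.List as List
open import Data.List.Extrema.Nat using (max)
open import Data.Nat using (ℕ; zero; suc; _∸_)
open import Data.Product using (∃; _×_; _,_; uncurry)
open import Data.Vec using (Vec; []; _∷_; lookup; tabulate; zipWith; foldr′; _[_]≔_; _[_]%=_)
open import Relation.Binary.PropositionalEquality using (_≢_)
open import Relation.Nullary using (Dec; does; ¬?; _×-dec_)
open import Relation.Unary using (Decidable)

-- The ring B of residues modulo 2 is Bool, with 0 = false, 1 = true,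
-- addition _xor_ and multiplication _∧_.
B^ : ℕ → Set
B^ n = Vec Bool n

-- Elements are compared with _≗_ (equality of values at every point).
P₂ : ℕ → Set
P₂ n = B^ n → Bool

Essential : ∀ {n} → P₂ n → Fin n → Set
Essential f i = ∃ λ α → f α ≢ f (α [ i ]%= not)

-- B^ n and Subset n are the same type, so anySubset? searches all points.
essential? : ∀ {n} (f : P₂ n) → Decidable (Essential f)
essential? f i = anySubset? (λ α → ¬? (f α ≟ f (α [ i ]%= not)))

Ess : ∀ {n} → P₂ n → Subset n
Ess f = tabulate (λ i → does (essential? f i))

ess : ∀ {n} → P₂ n → ℕ
ess f = ∣ Ess f ∣

_⟨_←_⟩ : ∀ {n} → P₂ n → Fin n → Fin n → P₂ n
(f ⟨ i ← j ⟩) x = f (x [ i ]≔ lookup x j)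

essentialPairs : ∀ {n} → P₂ n → List (Fin n × Fin n)
essentialPairs {n} f = filter distinctEssential? (cartesianProduct (allFin n) (allFin n))
  where
  distinctEssential? : Decidable (uncurry (λ i j → i ∈ Ess f × j ∈ Ess f × i ≢ j))
  distinctEssential? (i , j) = (i ∈? Ess f) ×-dec (j ∈? Ess f) ×-dec ¬? (i Fin.≟ j)

-- The default 0 does not affect the maximum of a nonempty list of naturals;
-- it is used only when f has fewer than two essential variables, where the
-- gap is not meaningful. Truncated subtraction loses nothing, since an
-- identification minor never has more essential variables than f.
gap : ∀ {n} → P₂ n → ℕ
gap f = ess f ∸ max 0 (map (λ (i , j) → ess (f ⟨ i ← j ⟩)) (essentialPairs f))

points : ∀ n → List (B^ n)
points zero    = List.[ [] ]
points (suc n) = cartesianProductWith _∷_ (false List.∷ true List.∷ List.[]) (points n)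

⊕-coords : ∀ {n} → B^ n → Bool
⊕-coords = foldr′ _xor_ false

Od₂ : ∀ n → List (B^ n)
Od₂ n = filter (λ α → ⊕-coords α ≟ true) (points n)

Ev₂ : ∀ n → List (B^ n)
Ev₂ n = filter (λ α → ⊕-coords α ≟ false) (points n)

_^_ : Bool → Bool → Bool
x ^ α = does (x ≟ α)

-- x₁^α₁ ⋯ xₙ^αₙ
monomial : ∀ {n} → B^ n → P₂ n
monomial α x = foldr′ _∧_ true (zipWith _^_ x α)

⨁[_]monomial : ∀ {n} → List (B^ n) → P₂ n
⨁[ S ]monomial x = foldr _xor_ false (map (λ α → monomial α x) S)

{-# OPTIONS --safe #-}

-- Say that {i , j} kills k if f does not depend on x_k on the hyperplane
-- x_i = x_j.  If the gap is 2, every pair i ≠ j either kills some k ∉ {i , j} or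
-- is reflexive: f is invariant under flipping x_i and x_j simultaneously on the
-- hyperplane.
-- If {i , j} kills k, then {i , k} is not reflexive and does not kill j:
-- otherwise the condition on {j , k} either makes some variable inessential or
-- forces f to be, on the coordinates i, j, k, a function of a majority of
-- literals, and then the condition on {i , l} fails for a fourth variable l.
-- Hence {i , k} kills some m ∉ {i , j , k}, and every {i , p} that kills k also
-- kills m.  Iterating from k to m, the set {p : {i , p} kills k} grows for ever,
-- so no pair kills anything.  Thus all pairs are reflexive, whence f(x) depends
-- only on the parity of x.
module Submission where

open import Defs
open import Data.Bool using (Bool; true; false; not; _∧_; _∨_; _xor_; _≟_)
open import Data.Bool.Properties
  using (∧-identityʳ; ∧-zeroʳ; not-involutive; ¬-not; not-¬; xor-assoc; xor-identityʳ;
         not-distribʳ-xor; not-distribˡ-xor)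
open import Data.Fin using (Fin; zero; suc)
import Data.Fin as Fin
open import Data.Fin.Properties using (¬∀⟶∃¬; any?; pigeonhole; <⇒≢)
open import Data.Fin.Subset
  using (Subset; inside; outside; _∈_; _∉_; _⊆_; _⊃_; ∣_∣; ⊤; ⁅_⁆; _∪_; Nonempty)
open import Data.Fin.Subset.Properties
  using (_∈?_; ∈⊤; ∣⊤∣≡n; p⊆q⇒∣p∣≤∣q∣; x∈⁅x⁆; x∈⁅y⁆⇒x≡y; x∈p∪q⁻; p⊆p∪q; q⊆p∪q)
open import Data.Fin.Subset.Induction using (⊃-wellFounded; Acc; acc)
open import Data.List using (List; []; _∷_; _++_; filter; foldr; map; allFin; cartesianProduct)
open import Data.List.Extrema.Nat using (max; max≈v⁺; xs≤max)
open import Data.List.Membership.Propositional.Properties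
  using (∈-filter⁺; ∈-filter⁻; ∈-map⁺; ∈-allFin; ∈-cartesianProduct⁺)
open import Data.List.Properties using (map-∘; map-cong; ++-identityʳ)
import Data.List.Membership.Propositional as L
import Data.List.Relation.Unary.All as All
import Data.List.Relation.Unary.All.Properties as All
open import Data.Nat using (ℕ; zero; suc; _∸_; _≤_; _<_; z≤n; s≤s)
open import Data.Nat.Properties
  using (≤-trans; ≤-reflexive; suc-injective; 1+n≰n; n≤1+n;
         ∸-monoʳ-≤; ∸-monoˡ-≤; m+n∸n≡m; module ≤-Reasoning)
open import Data.Product using (∃; _×_; _,_; proj₁; proj₂)
open import Data.Sum using (_⊎_; inj₁; inj₂)
open import Data.Vec using (Vec; []; _∷_; lookup; replicate; _[_]≔_; _[_]%=_; there; here)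
open import Data.Vec.Properties
  using ([]≔-commutes; []≔-lookup; lookup∘update; lookup∘update′; lookup∘tabulate; lookup-replicate;
         tabulate-cong; tabulate∘lookup; updateAt-updateAt; updateAt-updateAt-local; updateAt-commutes;
         lookup⇒[]=; []=⇒lookup; updateAt-cong-local; lookup∘updateAt; lookup∘updateAt′)
open import Function using (_∘_; mk⇔)
open import Function.Bundles using (_⇔_)
open import Relation.Binary.PropositionalEquality
  using (_≡_; _≢_; _≗_; refl; sym; trans; cong; cong₂; subst; subst₂; ≢-sym; module ≡-Reasoning)
open import Relation.Nullary using (¬_; does; yes; no; contradiction)
open import Relation.Nullary.Decidable using (dec-true; dec-false; decidable-stable; _⊎-dec_)
open import Relation.Unary using (Decidable)

private variable
  n : ℕ

-- Ways in which a variable can be lost on a hyperplane.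

Inessential : P₂ n → Fin n → Set
Inessential f k = ∀ x a b → f (x [ k ]≔ a) ≡ f (x [ k ]≔ b)

-- Overwriting both coordinates with one `a` parametrises the hyperplane x_i = x_j, so no equation
-- between coordinates has to be carried along.
Kills : P₂ n → Fin n → Fin n → Fin n → Set
Kills f i j k = ∀ x a b c → f (x [ i ]≔ a [ j ]≔ a [ k ]≔ b) ≡ f (x [ i ]≔ a [ j ]≔ a [ k ]≔ c)

Reflexive : P₂ n → Fin n → Fin n → Set
Reflexive f i j = ∀ x a b → f (x [ i ]≔ a [ j ]≔ a) ≡ f (x [ i ]≔ b [ j ]≔ b)

¬essential⇒inessential : ∀ {f : P₂ n} {k} → ¬ Essential f k → Inessential f k
¬essential⇒inessential {f = f} {k} ¬ess x a b with a ≟ b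
... | yes refl = refl
... | no a≢b = decidable-stable (f (x [ k ]≔ a) ≟ f (x [ k ]≔ b)) λ ne →
  ¬ess (x [ k ]≔ a , λ eq → ne (trans eq (cong f flip)))
  where
  flip : x [ k ]≔ a [ k ]%= not ≡ x [ k ]≔ b
  flip = updateAt-updateAt-local k x (sym (¬-not (a≢b ∘ sym)))

essential⇒¬inessential : ∀ {f : P₂ n} {k} → Essential f k → ¬ Inessential f k
essential⇒¬inessential {f = f} {k} (x , ne) iness = ne (begin
  f x                             ≡⟨ cong f ([]≔-lookup x k) ⟨
  f (x [ k ]≔ lookup x k)         ≡⟨ iness x _ _ ⟩
  f (x [ k ]≔ not (lookup x k))   ≡⟨ cong f (updateAt-cong-local k x refl) ⟩
  f (x [ k ]%= not)               ∎)
  where open ≡-Reasoning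

-- Reordering of updates

module _ {A : Set} (x : Vec A n) where

  swap : ∀ {i j a b} → i ≢ j → x [ i ]≔ a [ j ]≔ b ≡ x [ j ]≔ b [ i ]≔ a
  swap = []≔-commutes x _ _

module _ {A : Set} (x : Vec A n) {i j k : Fin n} {a b c : A} where

  last-to-front₃ : i ≢ k → j ≢ k →
    x [ i ]≔ a [ j ]≔ b [ k ]≔ c ≡ x [ k ]≔ c [ i ]≔ a [ j ]≔ b
  last-to-front₃ i≢k j≢k =
    trans (swap (x [ i ]≔ a) j≢k) (cong (_[ j ]≔ b) (swap x i≢k))

  last-to-front₄ : ∀ {l d} → i ≢ l → j ≢ l → k ≢ l →
    x [ i ]≔ a [ j ]≔ b [ k ]≔ c [ l ]≔ d ≡ x [ l ]≔ d [ i ]≔ a [ j ]≔ b [ k ]≔ c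
  last-to-front₄ i≢l j≢l k≢l =
    trans (swap (x [ i ]≔ a [ j ]≔ b) k≢l)
      (cong (_[ k ]≔ c) (trans (swap (x [ i ]≔ a) j≢l) (cong (_[ j ]≔ b) (swap x i≢l))))

-- {i , p} makes x_l irrelevant, so x_l may be set equal to x_i, where x_m is
-- irrelevant too.
kills-trans : ∀ {f : P₂ n} {i p l m} → i ≢ p → i ≢ m → p ≢ m → l ≢ m →
  Kills f i p l → Kills f i l m → Kills f i p m
kills-trans {f = f} {i} {p} {l} {m} i≢p i≢m p≢m l≢m ipl ilm x a b c = begin
  f (y [ m ]≔ b)                    ≡⟨ cong (λ z → f (z [ m ]≔ b)) ([]≔-lookup y l) ⟨
  f (y [ l ]≔ d [ m ]≔ b)           ≡⟨ to-a b ⟩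
  f (y [ l ]≔ a [ m ]≔ b)           ≡⟨ cong f (at-a b) ⟩
  f (x [ p ]≔ a [ i ]≔ a [ l ]≔ a [ m ]≔ b)  ≡⟨ ilm (x [ p ]≔ a) a b c ⟩
  f (x [ p ]≔ a [ i ]≔ a [ l ]≔ a [ m ]≔ c)  ≡⟨ cong f (at-a c) ⟨
  f (y [ l ]≔ a [ m ]≔ c)           ≡⟨ to-a c ⟨
  f (y [ l ]≔ d [ m ]≔ c)           ≡⟨ cong (λ z → f (z [ m ]≔ c)) ([]≔-lookup y l) ⟩
  f (y [ m ]≔ c)                    ∎
  where
  open ≡-Reasoning
  y = x [ i ]≔ a [ p ]≔ a
  d = lookup y l
  at-a : ∀ e → y [ l ]≔ a [ m ]≔ e ≡ x [ p ]≔ a [ i ]≔ a [ l ]≔ a [ m ]≔ e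
  at-a e = cong (λ z → z [ l ]≔ a [ m ]≔ e) (swap x i≢p)
  to-a : ∀ e → f (y [ l ]≔ d [ m ]≔ e) ≡ f (y [ l ]≔ a [ m ]≔ e)
  to-a e = begin
    f (y [ l ]≔ d [ m ]≔ e)  ≡⟨ cong f (last-to-front₄ x i≢m p≢m l≢m) ⟩
    f (x [ m ]≔ e [ i ]≔ a [ p ]≔ a [ l ]≔ d)  ≡⟨ ipl (x [ m ]≔ e) a d a ⟩
    f (x [ m ]≔ e [ i ]≔ a [ p ]≔ a [ l ]≔ a)  ≡⟨ cong f (last-to-front₄ x i≢m p≢m l≢m) ⟨
    f (y [ l ]≔ a [ m ]≔ e)  ∎

maj : Bool → Bool → Bool → Bool
maj false b c = b ∧ c
maj true  b c = b ∨ c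

-- Three coordinates

module Cube (f : P₂ n) (i j k : Fin n) (i≢j : i ≢ j) (i≢k : i ≢ k) (j≢k : j ≢ k) where

  open ≡-Reasoning

  cube : B^ n → Bool → Bool → Bool → Bool
  cube x a b c = f (x [ i ]≔ a [ j ]≔ b [ k ]≔ c)

  diag : B^ n → Bool → Bool
  diag x t = cube x t t t

  cube-lookup : ∀ x → cube x (lookup x i) (lookup x j) (lookup x k) ≡ f x
  cube-lookup x = cong f (begin
    x [ i ]≔ lookup x i [ j ]≔ lookup x j [ k ]≔ lookup x k
      ≡⟨ cong (λ z → z [ j ]≔ lookup x j [ k ]≔ lookup x k) ([]≔-lookup x i) ⟩
    x [ j ]≔ lookup x j [ k ]≔ lookup x k
      ≡⟨ cong (λ z → z [ k ]≔ lookup x k) ([]≔-lookup x j) ⟩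
    x [ k ]≔ lookup x k
      ≡⟨ []≔-lookup x k ⟩
    x ∎)

  -- Every point is a vertex of its own cube, at its own entries, so identities on cubes reach all
  -- points.
  inessential-k : (∀ x a b c c′ → cube x a b c ≡ cube x a b c′) → Inessential f k
  inessential-k h x c c′ = trans (sym (in-cube c)) (trans (h x _ _ c c′) (in-cube c′))
    where
    in-cube : ∀ c → cube x (lookup x i) (lookup x j) c ≡ f (x [ k ]≔ c)
    in-cube c = cong (λ z → f (z [ k ]≔ c))
      (trans (cong (_[ j ]≔ lookup x j) ([]≔-lookup x i)) ([]≔-lookup x j))

  inessential-other : ∀ {m} → m ≢ i → m ≢ j → m ≢ k →
    (∀ x a b c d d′ → cube (x [ m ]≔ d) a b c ≡ cube (x [ m ]≔ d′) a b c) → Inessential f m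
  inessential-other {m} m≢i m≢j m≢k h x d d′ =
    trans (sym (in-cube d)) (trans (h x _ _ _ d d′) (in-cube d′))
    where
    in-cube : ∀ d → cube (x [ m ]≔ d) (lookup x i) (lookup x j) (lookup x k) ≡ f (x [ m ]≔ d)
    in-cube d
      -- Setting x_m leaves the entries at i, j, k alone, so the entries of x also locate the
      -- updated point in its cube.
      rewrite sym (lookup∘update′ (≢-sym m≢i) x d)
            | sym (lookup∘update′ (≢-sym m≢j) x d)
            | sym (lookup∘update′ (≢-sym m≢k) x d) = cube-lookup (x [ m ]≔ d)

  kills-ik-j : Kills f i k j → ∀ x a b b′ → cube x a b a ≡ cube x a b′ a
  kills-ik-j K x a b b′ = begin
    cube x a b a                          ≡⟨ cong f (swap (x [ i ]≔ a) j≢k) ⟩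
    f (x [ i ]≔ a [ k ]≔ a [ j ]≔ b)      ≡⟨ K x a b b′ ⟩
    f (x [ i ]≔ a [ k ]≔ a [ j ]≔ b′)     ≡⟨ cong f (swap (x [ i ]≔ a) j≢k) ⟨
    cube x a b′ a                         ∎

  kills-jk-i : Kills f j k i → ∀ x a a′ b → cube x a b b ≡ cube x a′ b b
  kills-jk-i K x a a′ b = begin
    cube x a b b                          ≡⟨ cong f (last-to-front₃ x (≢-sym i≢j) (≢-sym i≢k)) ⟨
    f (x [ j ]≔ b [ k ]≔ b [ i ]≔ a)      ≡⟨ K x b a a′ ⟩
    f (x [ j ]≔ b [ k ]≔ b [ i ]≔ a′)     ≡⟨ cong f (last-to-front₃ x (≢-sym i≢j) (≢-sym i≢k)) ⟩
    cube x a′ b b                         ∎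

  kills-jk-other : ∀ {m} → m ≢ i → m ≢ j → m ≢ k → Kills f j k m →
    ∀ x a b d d′ → cube (x [ m ]≔ d) a b b ≡ cube (x [ m ]≔ d′) a b b
  kills-jk-other m≢i m≢j m≢k K x a b d d′ = begin
    cube (x [ _ ]≔ d) a b b    ≡⟨ cong f (last-to-front₄ x (≢-sym m≢i) (≢-sym m≢j) (≢-sym m≢k)) ⟨
    _                          ≡⟨ K (x [ i ]≔ a) b d d′ ⟩
    _                          ≡⟨ cong f (last-to-front₄ x (≢-sym m≢i) (≢-sym m≢j) (≢-sym m≢k)) ⟩
    cube (x [ _ ]≔ d′) a b b   ∎

  reflexive-ik : Reflexive f i k → ∀ x a b a′ → cube x a b a ≡ cube x a′ b a′
  reflexive-ik R x a b a′ = begin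
    cube x a b a                          ≡⟨ cong (λ z → f (z [ k ]≔ a)) (swap x i≢j) ⟩
    f (x [ j ]≔ b [ i ]≔ a [ k ]≔ a)      ≡⟨ R (x [ j ]≔ b) a a′ ⟩
    f (x [ j ]≔ b [ i ]≔ a′ [ k ]≔ a′)    ≡⟨ cong (λ z → f (z [ k ]≔ a′)) (swap x i≢j) ⟨
    cube x a′ b a′                        ∎

  -- On the coordinates i, j, k, f is the majority of x_i, x_j, s ⊕ x_k.
  MajorityLike : Bool → Set
  MajorityLike s = ∀ x a b c → cube x a b (s xor c) ≡ diag x (maj a b c)

  -- Two of three bits agree; the kill belonging to that pair moves the third bit to their common
  -- value, which is the majority.
  majority-kills : Kills f i j k → Kills f i k j → Kills f j k i → MajorityLike false
  majority-kills ijk ikj jki x false false c     = ijk x false c false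
  majority-kills ijk ikj jki x false true  false = kills-ik-j ikj x false true false
  majority-kills ijk ikj jki x false true  true  = kills-jk-i jki x false true true
  majority-kills ijk ikj jki x true  false false = kills-jk-i jki x true false false
  majority-kills ijk ikj jki x true  false true  = kills-ik-j ikj x true false true
  majority-kills ijk ikj jki x true  true  c     = ijk x true c true

  -- If x_i ≠ x_j, then x_k equals one of them, and reflecting that pair carries it to the value of
  -- the other. This value is the majority once x_k is negated.
  majority-reflexive : Kills f i j k → Reflexive f i k → Reflexive f j k → MajorityLike true
  majority-reflexive ijk ik jk x false false c     = ijk x false (not c) false
  majority-reflexive ijk ik jk x false true  false = jk (x [ i ]≔ false) true false
  majority-reflexive ijk ik jk x false true  true  = reflexive-ik ik x false true true
  majority-reflexive ijk ik jk x true  false false = reflexive-ik ik x true false false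
  majority-reflexive ijk ik jk x true  false true  = jk (x [ i ]≔ true) false true
  majority-reflexive ijk ik jk x true  true  c     = ijk x true (not c) true

  -- Majority-like functions and a fourth variable.

  module _ s (M : MajorityLike s) where

    cube-diag : ∀ x a b c → cube x a b c ≡ diag x (maj a b (s xor c))
    cube-diag x a b c = trans (cong (cube x a b) (xor-cancel s c)) (M x a b (s xor c))
      where
      xor-cancel : ∀ s c → c ≡ s xor (s xor c)
      xor-cancel false c = refl
      xor-cancel true  c = sym (not-involutive c)

    majority-essential-k : Essential f k → ¬ (∀ x → diag x false ≡ diag x true)
    majority-essential-k ess const = essential⇒¬inessential ess (inessential-k λ x a b c c′ →
      trans (cube-diag x a b c) (trans (diag-const x _ _) (sym (cube-diag x a b c′))))
      where
      diag-const : ∀ x t u → diag x t ≡ diag x u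
      diag-const x false false = refl
      diag-const x false true  = const x
      diag-const x true  false = sym (const x)
      diag-const x true  true  = refl

    majority-essential-other : ∀ {m} → m ≢ i → m ≢ j → m ≢ k → Essential f m →
      ¬ (∀ x t d d′ → diag (x [ m ]≔ d) t ≡ diag (x [ m ]≔ d′) t)
    majority-essential-other m≢i m≢j m≢k ess const =
      essential⇒¬inessential ess (inessential-other m≢i m≢j m≢k λ x a b c d d′ →
        trans (cube-diag _ a b c) (trans (const x _ d d′) (sym (cube-diag _ a b c))))

    module _ (essential : ∀ m → Essential f m) {l} (l≢i : l ≢ i) (l≢j : l ≢ j) (l≢k : l ≢ k) where

      -- This permits a case distinction on x_l: conditions on the pair {i, l} speak of points where
      -- x_l is set explicitly.
      on-both-sides : ∀ {P : B^ n → Set} → (∀ x (a : Bool) → P (x [ l ]≔ a)) → ∀ x → P x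
      on-both-sides {P} h x = subst P ([]≔-lookup x l) (h x (lookup x l))

      reorder : ∀ (x : B^ n) {a b c d} →
        x [ j ]≔ b [ k ]≔ c [ i ]≔ a [ l ]≔ d ≡ x [ l ]≔ d [ i ]≔ a [ j ]≔ b [ k ]≔ c
      reorder x = trans (last-to-front₄ x (≢-sym l≢j) (≢-sym l≢k) (≢-sym l≢i))
        (last-to-front₃ (x [ l ]≔ _) (≢-sym i≢j) (≢-sym i≢k))

      reorder-il-j : ∀ (x : B^ n) {a b c d} →
        x [ k ]≔ c [ i ]≔ a [ l ]≔ d [ j ]≔ b ≡ x [ l ]≔ d [ i ]≔ a [ j ]≔ b [ k ]≔ c
      reorder-il-j x = trans (last-to-front₄ x (≢-sym j≢k) i≢j l≢j) (reorder x)

      reorder-il-k : ∀ (x : B^ n) {a b c d} →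
        x [ j ]≔ b [ i ]≔ a [ l ]≔ d [ k ]≔ c ≡ x [ l ]≔ d [ i ]≔ a [ j ]≔ b [ k ]≔ c
      reorder-il-k x = trans (last-to-front₄ x j≢k i≢k l≢k)
        (trans (cong (λ z → z [ i ]≔ _ [ l ]≔ _) (swap x (≢-sym j≢k))) (reorder x))

      ¬reflexive-il : ¬ Reflexive f i l
      ¬reflexive-il R = majority-essential-k (essential k) (on-both-sides λ where
          -- The reflection reverses the majority of x_i, b, c if b ≠ c and preserves it if b = c;
          -- one instance of each equates the two diagonal values.
          x false → trans (step x false true false) (sym (step x false true true))
          x true  → trans (sym (step x false false false)) (step x false true false))
        where
        step : ∀ x a b c →
          diag (x [ l ]≔ a) (maj a b c) ≡ diag (x [ l ]≔ not a) (maj (not a) b c)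
        step x a b c = begin
          diag (x [ l ]≔ a) (maj a b c)              ≡⟨ M _ a b c ⟨
          cube (x [ l ]≔ a) a b (s xor c)            ≡⟨ cong f (reorder x) ⟨
          _                                          ≡⟨ R (x [ j ]≔ b [ k ]≔ (s xor c)) a (not a) ⟩
          _                                          ≡⟨ cong f (reorder x) ⟩
          cube (x [ l ]≔ not a) (not a) b (s xor c)  ≡⟨ M _ (not a) b c ⟩
          diag (x [ l ]≔ not a) (maj (not a) b c)    ∎

      -- When x_i and the third literal are opposite, x_j alone decides the majority, so killing x_j
      -- equates both diagonal values. The argument for k exchanges x_j and the third literal.
      ¬kills-il-j : ¬ Kills f i l j
      ¬kills-il-j K = majority-essential-k (essential k) (on-both-sides λ where
          x false → step x false true
          x true  → step x true false)
        where
        step : ∀ x a c → diag (x [ l ]≔ a) (maj a false c) ≡ diag (x [ l ]≔ a) (maj a true c)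
        step x a c = begin
          diag (x [ l ]≔ a) (maj a false c)          ≡⟨ M _ a false c ⟨
          cube (x [ l ]≔ a) a false (s xor c)        ≡⟨ cong f (reorder-il-j x) ⟨
          _                                          ≡⟨ K (x [ k ]≔ (s xor c)) a false true ⟩
          _                                          ≡⟨ cong f (reorder-il-j x) ⟩
          cube (x [ l ]≔ a) a true (s xor c)         ≡⟨ M _ a true c ⟩
          diag (x [ l ]≔ a) (maj a true c)           ∎

      ¬kills-il-k : ¬ Kills f i l k
      ¬kills-il-k K = majority-essential-k (essential k) (on-both-sides λ where
          x false → step x false true
          x true  → step x true false)
        where
        step : ∀ x a b → diag (x [ l ]≔ a) (maj a b false) ≡ diag (x [ l ]≔ a) (maj a b true)
        step x a b = begin
          diag (x [ l ]≔ a) (maj a b false)          ≡⟨ M _ a b false ⟨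
          cube (x [ l ]≔ a) a b (s xor false)        ≡⟨ cong f (reorder-il-k x) ⟨
          _                                          ≡⟨ K (x [ j ]≔ b) a (s xor false) (s xor true) ⟩
          _                                          ≡⟨ cong f (reorder-il-k x) ⟩
          cube (x [ l ]≔ a) a b (s xor true)         ≡⟨ M _ a b true ⟩
          diag (x [ l ]≔ a) (maj a b true)           ∎

      -- If x_j and the third literal both equal t, the majority is t whatever x_i is. So x_i may
      -- copy x_l, and the kill shows that no diagonal value depends on x_m.
      ¬kills-il-other : ∀ {m} → m ≢ i → m ≢ j → m ≢ k → m ≢ l → ¬ Kills f i l m
      ¬kills-il-other {m} m≢i m≢j m≢k m≢l K =
        majority-essential-other m≢i m≢j m≢k (essential m) λ x t d d′ →
          on-both-sides {P = λ x → diag (x [ m ]≔ d) t ≡ diag (x [ m ]≔ d′) t}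
            (λ x a → subst₂ (λ y z → diag y t ≡ diag z t) (swap x m≢l) (swap x m≢l) (step x a t d d′)) x
        where
        reorder-m : ∀ (x : B^ n) {a b c d} →
          x [ j ]≔ b [ k ]≔ c [ i ]≔ a [ l ]≔ a [ m ]≔ d
            ≡ x [ m ]≔ d [ l ]≔ a [ i ]≔ a [ j ]≔ b [ k ]≔ c
        reorder-m x = trans (swap _ (≢-sym m≢l)) (trans
          (cong (_[ l ]≔ _) (last-to-front₄ x (≢-sym m≢j) (≢-sym m≢k) (≢-sym m≢i))) (reorder _))
        maj-same : ∀ a t → maj a t t ≡ t
        maj-same false false = refl
        maj-same false true  = refl
        maj-same true  false = refl
        maj-same true  true  = refl
        at-diag : ∀ x a t → cube x a t (s xor t) ≡ diag x t
        at-diag x a t = trans (M x a t t) (cong (diag x) (maj-same a t))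
        step : ∀ x a t d d′ → diag (x [ m ]≔ d [ l ]≔ a) t ≡ diag (x [ m ]≔ d′ [ l ]≔ a) t
        step x a t d d′ = begin
          diag (x [ m ]≔ d [ l ]≔ a) t               ≡⟨ at-diag _ a t ⟨
          cube (x [ m ]≔ d [ l ]≔ a) a t (s xor t)   ≡⟨ cong f (reorder-m x) ⟨
          _                                          ≡⟨ K (x [ j ]≔ t [ k ]≔ (s xor t)) a d d′ ⟩
          _                                          ≡⟨ cong f (reorder-m x) ⟩
          cube (x [ m ]≔ d′ [ l ]≔ a) a t (s xor t)  ≡⟨ at-diag _ a t ⟩
          diag (x [ m ]≔ d′ [ l ]≔ a) t              ∎

-- Otherwise choosing a position for every element of `Fin n` would map it injectively into the
-- smaller `Fin m`.
fresh : ∀ {m} → m < n → (v : Vec (Fin n) m) → ∃ λ l → ∀ q → l ≢ lookup v q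
fresh {n} m<n v with ¬∀⟶∃¬ n (λ l → ∃ λ q → l ≡ lookup v q) (λ l → any? λ q → l Fin.≟ lookup v q) ¬covering
  where
  ¬covering : ¬ (∀ l → ∃ λ q → l ≡ lookup v q)
  ¬covering h with pigeonhole m<n (proj₁ ∘ h)
  ... | a , b , a<b , eq = <⇒≢ a<b (begin
    a                        ≡⟨ proj₂ (h a) ⟩
    lookup v (proj₁ (h a))   ≡⟨ cong (lookup v) eq ⟩
    lookup v (proj₁ (h b))   ≡⟨ proj₂ (h b) ⟨
    b                        ∎)
    where open ≡-Reasoning
... | l , ¬hit = l , λ q eq → ¬hit (q , eq)

-- Functions for which every identification loses a second variable.

module Lossy (4≤n : 4 ≤ n) (f : P₂ n) (essential : ∀ i → Essential f i)
  (lossy : ∀ {i j} → i ≢ j → Reflexive f i j ⊎ ∃ λ k → k ≢ i × k ≢ j × Kills f i j k) where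

  -- A fourth variable is what excludes these functions: the majority of three variables itself has
  -- gap 2. Either outcome for the pair {i, l} makes an essential variable inessential.
  ¬majorityLike : ∀ {i j k} (i≢j : i ≢ j) (i≢k : i ≢ k) (j≢k : j ≢ k) →
    ∀ s → ¬ Cube.MajorityLike f i j k i≢j i≢k j≢k s
  ¬majorityLike {i} {j} {k} i≢j i≢k j≢k s M
    with fresh 4≤n (i ∷ j ∷ k ∷ [])
  ... | l , l∉ = excluded (lossy (≢-sym l≢i))
    where
    l≢i : l ≢ i
    l≢i = l∉ zero
    l≢j : l ≢ j
    l≢j = l∉ (suc zero)
    l≢k : l ≢ k
    l≢k = l∉ (suc (suc zero))
    open Cube f i j k i≢j i≢k j≢k
    excluded : ¬ (Reflexive f i l ⊎ ∃ λ m → m ≢ i × m ≢ l × Kills f i l m)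
    excluded (inj₁ R) = ¬reflexive-il s M essential l≢i l≢j l≢k R
    excluded (inj₂ (m , m≢i , m≢l , K)) with m Fin.≟ j | m Fin.≟ k
    ... | yes refl | _        = ¬kills-il-j s M essential l≢i l≢j l≢k K
    ... | no  _    | yes refl = ¬kills-il-k s M essential l≢i l≢j l≢k K
    ... | no  m≢j  | no  m≢k  = ¬kills-il-other s M essential l≢i l≢j l≢k m≢i m≢j m≢k m≢l K

  module _ {i j k} (i≢j : i ≢ j) (i≢k : i ≢ k) (j≢k : j ≢ k) (ijk : Kills f i j k) where

    open Cube f i j k i≢j i≢k j≢k

    -- If {j , k} kills some m ≠ i, every point of the cube can be moved into the
    -- plane x_j = x_k, so that m is inessential; in the remaining mixed case the
    -- two points differing in x_k only can be moved to the same point.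
    kills⇒¬reflexive : ¬ Reflexive f i k
    kills⇒¬reflexive R with lossy j≢k
    ... | inj₁ R′ = ¬majorityLike i≢j i≢k j≢k true (majority-reflexive ijk R R′)
    ... | inj₂ (m , m≢j , m≢k , K) with m Fin.≟ i
    ...   | yes refl = essential⇒¬inessential (essential k) (inessential-k same)
      where
      to-diag : ∀ x a b c → a ≢ b → cube x a b c ≡ diag x b
      to-diag x false false c     a≢b = contradiction refl a≢b
      to-diag x true  true  c     a≢b = contradiction refl a≢b
      to-diag x false true  false a≢b = reflexive-ik R x false true true
      to-diag x false true  true  a≢b = kills-jk-i K x false true true
      to-diag x true  false false a≢b = kills-jk-i K x true false false
      to-diag x true  false true  a≢b = reflexive-ik R x true false false
      same : ∀ x a b c c′ → cube x a b c ≡ cube x a b c′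
      same x a b c c′ with a ≟ b
      ... | yes refl = ijk x a c c′
      ... | no a≢b = trans (to-diag x a b c a≢b) (sym (to-diag x a b c′ a≢b))
    ...   | no m≢i = essential⇒¬inessential (essential m) (inessential-other m≢i m≢j m≢k same)
      where
      on-jk = kills-jk-other m≢i m≢j m≢k K
      same : ∀ x a b c d d′ → cube (x [ m ]≔ d) a b c ≡ cube (x [ m ]≔ d′) a b c
      same x a b c d d′ with b ≟ c
      ... | yes refl = on-jk x a b d d′
      ... | no b≢c with a ≟ b
      ...   | yes refl = trans (ijk _ a c a) (trans (on-jk x a a d d′) (ijk _ a a c))
      -- There are only two bits: a ≠ b and b ≠ c give c = a, and reflecting x_i and x_k to b
      -- reaches the plane x_j = x_k.
      ...   | no a≢b with refl ← trans (¬-not a≢b) (sym (¬-not (b≢c ∘ sym))) =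
        trans (reflexive-ik R _ a b b) (trans (on-jk x b b d d′) (reflexive-ik R _ b b a))

    -- If {j , k} is reflexive, every point of the cube moves to the diagonal at x_i, so k is
    -- inessential. If it kills i, a majority results. If it kills another m, the two given kills
    -- move every point into the plane x_j = x_k, so m is inessential.
    kills⇒¬kills : ¬ Kills f i k j
    kills⇒¬kills ikj with lossy j≢k
    ... | inj₁ R = essential⇒¬inessential (essential k) (inessential-k same)
      where
      same : ∀ x a b c c′ → cube x a b c ≡ cube x a b c′
      same x a b c c′ = trans (to-diag x a b c) (sym (to-diag x a b c′))
        where
        to-diag : ∀ x a b c → cube x a b c ≡ diag x a
        to-diag x a b c with b ≟ c
        ... | yes refl = R (x [ i ]≔ a) b a
        ... | no b≢c with a ≟ b
        ...   | yes refl = ijk x a c a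
        ...   | no a≢b with refl ← trans (¬-not a≢b) (sym (¬-not (b≢c ∘ sym))) =
          kills-ik-j ikj x a b a
    ... | inj₂ (m , m≢j , m≢k , K) with m Fin.≟ i
    ...   | yes refl = ¬majorityLike i≢j i≢k j≢k false (majority-kills ijk ikj K)
    ...   | no m≢i = essential⇒¬inessential (essential m) (inessential-other m≢i m≢j m≢k same)
      where
      on-jk = kills-jk-other m≢i m≢j m≢k K
      same : ∀ x a b c d d′ → cube (x [ m ]≔ d) a b c ≡ cube (x [ m ]≔ d′) a b c
      same x a b c d d′ with b ≟ c
      ... | yes refl = on-jk x a b d d′
      ... | no b≢c with a ≟ b
      ...   | yes refl = trans (ijk _ a c a) (trans (on-jk x a a d d′) (ijk _ a a c))
      ...   | no a≢b with refl ← trans (¬-not a≢b) (sym (¬-not (b≢c ∘ sym))) =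
        trans (kills-ik-j ikj _ a b a) (trans (on-jk x a a d d′) (kills-ik-j ikj _ a a b))

  -- Each round moves k into S and takes a new m as the target. The set grows strictly inside a
  -- finite one, which is the well-founded order recursed on; its member q supplies the kill that
  -- rules out reflexivity of {i , k}.
  ¬kills-set : ∀ {S : Subset n} → Acc _⊃_ S → ∀ {i k} → i ≢ k → i ∉ S → k ∉ S → Nonempty S →
    ¬ (∀ {p} → p ∈ S → Kills f i p k)
  ¬kills-set {S} (acc larger) {i} {k} i≢k i∉S k∉S (q , q∈S) kills = step (lossy i≢k)
    where
    ∈S⇒≢ : ∀ {p r} → p ∈ S → r ∉ S → p ≢ r
    ∈S⇒≢ p∈S r∉S refl = r∉S p∈S
    S⁺ = S ∪ ⁅ k ⁆
    k∈S⁺ : k ∈ S⁺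
    k∈S⁺ = q⊆p∪q S ⁅ k ⁆ (x∈⁅x⁆ k)
    ∉S⁺ : ∀ {r} → r ∉ S → r ≢ k → r ∉ S⁺
    ∉S⁺ r∉S r≢k r∈S⁺ with x∈p∪q⁻ S ⁅ k ⁆ r∈S⁺
    ... | inj₁ r∈S = r∉S r∈S
    ... | inj₂ r∈k = r≢k (x∈⁅y⁆⇒x≡y k r∈k)
    step : ¬ (Reflexive f i k ⊎ ∃ λ m → m ≢ i × m ≢ k × Kills f i k m)
    step (inj₁ R) =
      kills⇒¬reflexive (≢-sym (∈S⇒≢ q∈S i∉S)) i≢k (∈S⇒≢ q∈S k∉S) (kills q∈S) R
    step (inj₂ (m , m≢i , m≢k , ikm)) with m ∈? S
    -- Here {i , m} would kill k while {i , k} kills m, which `kills⇒¬kills` forbids; so m is new.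
    ... | yes m∈S = kills⇒¬kills (≢-sym m≢i) i≢k m≢k (kills m∈S) ikm
    ... | no  m∉S =
      ¬kills-set (larger (p⊆p∪q ⁅ k ⁆ , k , k∈S⁺ , k∉S)) (≢-sym m≢i)
        (∉S⁺ i∉S i≢k) (∉S⁺ m∉S m≢k) (k , k∈S⁺) kills⁺
      where
      kills⁺ : ∀ {p} → p ∈ S⁺ → Kills f i p m
      kills⁺ p∈S⁺ with x∈p∪q⁻ S ⁅ k ⁆ p∈S⁺
      -- For an old member p the kill passes from k on to m; for the new member k it is the choice
      -- of m.
      ... | inj₁ p∈S = kills-trans {f = f} (≢-sym (∈S⇒≢ p∈S i∉S)) (≢-sym m≢i) (∈S⇒≢ p∈S m∉S) (≢-sym m≢k)
                         (kills p∈S) ikm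
      ... | inj₂ p∈k with refl ← x∈⁅y⁆⇒x≡y k p∈k = ikm

  all-reflexive : ∀ {i j} → i ≢ j → Reflexive f i j
  all-reflexive {i} {j} i≢j with lossy i≢j
  ... | inj₁ R = R
  ... | inj₂ (k , k≢i , k≢j , K) = contradiction
    (λ {p} p∈j → subst (λ p → Kills f i p k) (sym (x∈⁅y⁆⇒x≡y j p∈j)) K)
    -- A single killing pair {i , j} gives the starting set {j}.
    (¬kills-set (⊃-wellFounded ⁅ j ⁆) (≢-sym k≢i)
      (i≢j ∘ x∈⁅y⁆⇒x≡y j) (k≢j ∘ x∈⁅y⁆⇒x≡y j) (j , x∈⁅x⁆ j))

  open ≡-Reasoning

  -- A third coordinate k agrees with x_i or with x_j, so that two reflections
  -- through k flip i and j also when x_i ≠ x_j.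
  flip-two : ∀ {i j} → i ≢ j → ∀ x a b → f (x [ i ]≔ a [ j ]≔ b) ≡ f (x [ i ]≔ not a [ j ]≔ not b)
  flip-two {i} {j} i≢j x a b with fresh (≤-trans (n≤1+n 3) 4≤n) (i ∷ j ∷ [])
  ... | k , k∉ = begin
    f (x [ i ]≔ a [ j ]≔ b)                ≡⟨ cube-k a b ⟨
    cube x a b (lookup x k)                ≡⟨ flip a b (lookup x k) ⟩
    cube x (not a) (not b) (lookup x k)    ≡⟨ cube-k (not a) (not b) ⟩
    f (x [ i ]≔ not a [ j ]≔ not b)        ∎
    where
    i≢k = ≢-sym (k∉ zero)
    j≢k = ≢-sym (k∉ (suc zero))
    open Cube f i j k i≢j i≢k j≢k
    cube-k : ∀ a b → cube x a b (lookup x k) ≡ f (x [ i ]≔ a [ j ]≔ b)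
    cube-k a b = cong f (begin
      x [ i ]≔ a [ j ]≔ b [ k ]≔ lookup x k  ≡⟨ last-to-front₃ x i≢k j≢k ⟩
      x [ k ]≔ lookup x k [ i ]≔ a [ j ]≔ b  ≡⟨ cong (λ y → y [ i ]≔ a [ j ]≔ b) ([]≔-lookup x k) ⟩
      x [ i ]≔ a [ j ]≔ b                    ∎)
    flip-ij : ∀ a a′ c → cube x a a c ≡ cube x a′ a′ c
    flip-ij a a′ c = begin
      cube x a a c                          ≡⟨ cong f (last-to-front₃ x i≢k j≢k) ⟩
      f (x [ k ]≔ c [ i ]≔ a [ j ]≔ a)      ≡⟨ all-reflexive i≢j (x [ k ]≔ c) a a′ ⟩
      f (x [ k ]≔ c [ i ]≔ a′ [ j ]≔ a′)    ≡⟨ cong f (last-to-front₃ x i≢k j≢k) ⟨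
      cube x a′ a′ c                        ∎
    flip-ik : ∀ a b a′ → cube x a b a ≡ cube x a′ b a′
    flip-ik = reflexive-ik (all-reflexive i≢k) x
    flip-jk : ∀ a b b′ → cube x a b b ≡ cube x a b′ b′
    flip-jk a = all-reflexive j≢k (x [ i ]≔ a)
    flip : ∀ a b c → cube x a b c ≡ cube x (not a) (not b) c
    flip false false c     = flip-ij false true c
    flip true  true  c     = flip-ij true false c
    flip false true  false = trans (flip-ik false true true) (flip-jk true true false)
    flip false true  true  = trans (flip-jk false true false) (flip-ik false false true)
    flip true  false false = trans (flip-jk true false true) (flip-ik true true false)
    flip true  false true  = trans (flip-ik true false false) (flip-jk false false true)

-- The head serves as an accumulator: each true entry of the tail is cleared by flipping it together
-- with the head, which ends as the parity of the whole point.
parity-normal-form : (g : B^ (suc n) → Bool) →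
  (∀ a v i b → g (a ∷ v [ i ]≔ b) ≡ g (not a ∷ v [ i ]≔ not b)) →
  ∀ a v → g (a ∷ v) ≡ g ((a xor ⊕-coords v) ∷ replicate _ false)
parity-normal-form g flip a [] = cong (λ b → g (b ∷ [])) (sym (xor-identityʳ a))
parity-normal-form {n = suc n} g flip a (b ∷ v) = on-head b
  where
  open ≡-Reasoning
  -- Freezing the second entry at false leaves a function of one variable fewer with the same
  -- invariance.
  g₀ : B^ (suc n) → Bool
  g₀ (a ∷ v) = g (a ∷ false ∷ v)
  normal : ∀ a → g (a ∷ false ∷ v) ≡ g ((a xor ⊕-coords v) ∷ replicate _ false)
  normal a = parity-normal-form g₀ (λ a v i → flip a (false ∷ v) (suc i)) a v
  on-head : ∀ b → g (a ∷ b ∷ v) ≡ g ((a xor (b xor ⊕-coords v)) ∷ replicate _ false)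
  on-head false = normal a
  on-head true = begin
    g (a ∷ true ∷ v)           ≡⟨ flip a (true ∷ v) zero true ⟩
    g (not a ∷ false ∷ v)      ≡⟨ normal (not a) ⟩
    g ((not a xor ⊕-coords v) ∷ _)
      ≡⟨ cong (λ c → g (c ∷ _)) (trans (sym (not-distribˡ-xor a _)) (not-distribʳ-xor a _)) ⟩
    g ((a xor not (⊕-coords v)) ∷ _) ∎

-- Identification minors and the gap

-- Moving x_j in the minor moves x_i along with it in f.
minor-reflexive : ∀ (f : P₂ n) {i j} → i ≢ j → Inessential (f ⟨ i ← j ⟩) j → Reflexive f i j
minor-reflexive f {i} {j} i≢j iness x a b = begin
  f (x [ i ]≔ a [ j ]≔ a)          ≡⟨ at a ⟨
  (f ⟨ i ← j ⟩) (x [ j ]≔ a)       ≡⟨ iness x a b ⟩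
  (f ⟨ i ← j ⟩) (x [ j ]≔ b)       ≡⟨ at b ⟩
  f (x [ i ]≔ b [ j ]≔ b)          ∎
  where
  open ≡-Reasoning
  at : ∀ a → (f ⟨ i ← j ⟩) (x [ j ]≔ a) ≡ f (x [ i ]≔ a [ j ]≔ a)
  at a = cong f (trans (cong (x [ j ]≔ a [ i ]≔_) (lookup∘update j x a)) (swap x (≢-sym i≢j)))

minor-kills : ∀ (f : P₂ n) {i j k} → i ≢ j → i ≢ k → j ≢ k → Inessential (f ⟨ i ← j ⟩) k → Kills f i j k
minor-kills f {i} {j} {k} i≢j i≢k j≢k iness x a b c = begin
  f (x [ i ]≔ a [ j ]≔ a [ k ]≔ b)          ≡⟨ at b ⟨
  (f ⟨ i ← j ⟩) (x [ j ]≔ a [ k ]≔ b)       ≡⟨ iness (x [ j ]≔ a) b c ⟩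
  (f ⟨ i ← j ⟩) (x [ j ]≔ a [ k ]≔ c)       ≡⟨ at c ⟩
  f (x [ i ]≔ a [ j ]≔ a [ k ]≔ c)          ∎
  where
  open ≡-Reasoning
  at : ∀ b → (f ⟨ i ← j ⟩) (x [ j ]≔ a [ k ]≔ b) ≡ f (x [ i ]≔ a [ j ]≔ a [ k ]≔ b)
  at b = cong f (trans
    (cong (x [ j ]≔ a [ k ]≔ b [ i ]≔_)
      (trans (lookup∘update′ j≢k (x [ j ]≔ a) b) (lookup∘update j x a)))
    (last-to-front₃ x (≢-sym i≢j) (≢-sym i≢k)))

-- The variable x_i never survives, so only a further loss carries information: losing x_j is a
-- reflection, losing any other variable a kill.
minor-lossy : ∀ (f : P₂ n) {i j k} → i ≢ j → k ≢ i → ¬ Essential (f ⟨ i ← j ⟩) k →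
  Reflexive f i j ⊎ ∃ λ k → k ≢ i × k ≢ j × Kills f i j k
minor-lossy f {j = j} {k} i≢j k≢i ¬ess with k Fin.≟ j
... | yes refl = inj₁ (minor-reflexive f i≢j (¬essential⇒inessential ¬ess))
... | no k≢j   =
  inj₂ (k , k≢i , k≢j , minor-kills f i≢j (≢-sym k≢i) (≢-sym k≢j) (¬essential⇒inessential ¬ess))

Ess-unique : (f : P₂ n) (p : Subset n) → (∀ i → does (essential? f i) ≡ lookup p i) → Ess f ≡ p
Ess-unique f p h = trans (tabulate-cong h) (tabulate∘lookup p)

∈Ess : (f : P₂ n) → ∀ {i} → Essential f i → i ∈ Ess f
∈Ess f {i} e = lookup⇒[]= i (Ess f) (trans (lookup∘tabulate _ i) (dec-true (essential? f i) e))

ess-full : (f : P₂ n) → (∀ i → Essential f i) → ess f ≡ n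
ess-full {n} f essential = trans
  (cong ∣_∣ (Ess-unique f ⊤ λ i → trans (dec-true (essential? f i) (essential i)) (sym (lookup-replicate i inside))))
  (∣⊤∣≡n n)

∣p[i]≔outside∣ : ∀ (p : Subset n) {i} → i ∈ p → suc ∣ p [ i ]≔ outside ∣ ≡ ∣ p ∣
∣p[i]≔outside∣ (.true ∷ p) here = refl
∣p[i]≔outside∣ (false ∷ p) (there i∈p) = ∣p[i]≔outside∣ p i∈p
∣p[i]≔outside∣ (true  ∷ p) (there i∈p) = cong suc (∣p[i]≔outside∣ p i∈p)

∈essentialPairs : ∀ {f : P₂ n} → (∀ i → Essential f i) → ∀ {i j} → i ≢ j → (i , j) L.∈ essentialPairs f
∈essentialPairs {f = f} essential {i} {j} i≢j =
  ∈-filter⁺ _ (∈-cartesianProduct⁺ (∈-allFin i) (∈-allFin j))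
    (∈Ess f (essential i) , ∈Ess f (essential j) , i≢j)

essentialPairs-distinct : ∀ (f : P₂ n) {i j} → (i , j) L.∈ essentialPairs f → i ≢ j
essentialPairs-distinct {n} f ij∈ =
  proj₂ (proj₂ (proj₂ (∈-filter⁻ _ {xs = cartesianProduct (allFin n) (allFin n)} ij∈)))

-- If x_i were the only variable missing from the minor, at least n - 1 essential variables would
-- remain and the gap would be at most 1.
gap≡2⇒lossy : (f : P₂ n) → (∀ i → Essential f i) → gap f ≡ 2 →
  ∀ {i j} → i ≢ j → Reflexive f i j ⊎ ∃ λ k → k ≢ i × k ≢ j × Kills f i j k
gap≡2⇒lossy {n} f essential gap≡2 {i} {j} i≢j
  with ¬∀⟶∃¬ n (λ k → k ≡ i ⊎ Essential g k) (λ k → (k Fin.≟ i) ⊎-dec essential? g k) ¬all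
  where
  g = f ⟨ i ← j ⟩
  minors = map (λ (i , j) → ess (f ⟨ i ← j ⟩)) (essentialPairs f)
  ess-g≤max : ess g ≤ max 0 minors
  ess-g≤max = All.lookup (xs≤max 0 minors) (∈-map⁺ _ (∈essentialPairs essential i≢j))
  ¬all : ¬ (∀ k → k ≡ i ⊎ Essential g k)
  ¬all all = 1+n≰n (begin
    2                                ≡⟨ gap≡2 ⟨
    ess f ∸ max 0 minors             ≤⟨ ∸-monoʳ-≤ (ess f) ess-g≤max ⟩
    ess f ∸ ess g                    ≡⟨ cong (_∸ ess g) (trans (ess-full f essential) (sym (∣⊤∣≡n n))) ⟩
    ∣ ⊤ {n} ∣ ∸ ess g                ≡⟨ cong (_∸ ess g) (∣p[i]≔outside∣ ⊤ {i} ∈⊤) ⟨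
    suc ∣ ⊤ [ i ]≔ outside ∣ ∸ ess g ≤⟨ ∸-monoˡ-≤ (ess g) (s≤s (p⊆q⇒∣p∣≤∣q∣ ⊤-i⊆)) ⟩
    suc (ess g) ∸ ess g              ≡⟨ m+n∸n≡m 1 (ess g) ⟩
    1                                ∎)
    where
    open ≤-Reasoning
    ⊤-i⊆ : ⊤ [ i ]≔ outside ⊆ Ess g
    ⊤-i⊆ {k} k∈ with all k
    ... | inj₂ e = ∈Ess g e
    ... | inj₁ refl with () ← trans (sym ([]=⇒lookup k∈)) (lookup∘update i ⊤ outside)
... | k , ¬either = minor-lossy f i≢j (¬either ∘ inj₁) (¬either ∘ inj₂)

-- Functions that every single flip negates.

⊕-coords-flip : ∀ (x : B^ n) k → ⊕-coords (x [ k ]%= not) ≡ not (⊕-coords x)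
⊕-coords-flip (b ∷ x) zero = sym (not-distribˡ-xor b (⊕-coords x))
⊕-coords-flip (b ∷ x) (suc k) =
  trans (cong (b xor_) (⊕-coords-flip x k)) (sym (not-distribʳ-xor b (⊕-coords x)))

-- Identifying x_i with x_j ties two flips together, whose negations cancel, while each other flip
-- still negates the minor. Every minor thus has exactly n - 2 essential variables.
flipping⇒gap≡2 : 2 ≤ n → (f : P₂ n) → (∀ i → Essential f i) →
  (∀ x k → f (x [ k ]%= not) ≡ not (f x)) → gap f ≡ 2
-- The pattern exposes n as a double successor, so that `n ∸ 2` computes and the indices 0 and 1
-- exist.
flipping⇒gap≡2 {n} (s≤s (s≤s _)) f essential f-flip = begin
  ess f ∸ max 0 minors     ≡⟨ cong₂ _∸_ ess-f max-minors ⟩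
  suc (suc m) ∸ m          ≡⟨ m+n∸n≡m 2 m ⟩
  2                        ∎
  where
  open ≡-Reasoning
  minors = map (λ (i , j) → ess (f ⟨ i ← j ⟩)) (essentialPairs f)

  essential-minor : ∀ {i j k} → k ≢ i → k ≢ j → Essential (f ⟨ i ← j ⟩) k
  essential-minor {i} {j} {k} k≢i k≢j = x , λ eq → not-¬ refl (trans eq (begin
    f (x [ k ]%= not [ i ]≔ lookup (x [ k ]%= not) j)
      ≡⟨ cong (λ b → f (x [ k ]%= not [ i ]≔ b)) (lookup∘updateAt′ j k (≢-sym k≢j) x) ⟩
    f (x [ k ]%= not [ i ]≔ lookup x j)
      ≡⟨ cong f (updateAt-commutes i k (≢-sym k≢i) x) ⟩
    f (x [ i ]≔ lookup x j [ k ]%= not)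
      ≡⟨ f-flip _ k ⟩
    not ((f ⟨ i ← j ⟩) x) ∎))
    -- Any point is a witness, since every flip changes the value.
    where x = replicate n false

  ¬essential-minor-i : ∀ {i j} → i ≢ j → ¬ Essential (f ⟨ i ← j ⟩) i
  ¬essential-minor-i {i} {j} i≢j (x , ne) = ne (cong f (sym (trans
    (updateAt-updateAt i x)
    (cong (x [ i ]≔_) (lookup∘updateAt′ j i (≢-sym i≢j) x)))))

  ¬essential-minor-j : ∀ {i j} → i ≢ j → ¬ Essential (f ⟨ i ← j ⟩) j
  ¬essential-minor-j {i} {j} i≢j (x , ne) = ne (sym (begin
    f (x [ j ]%= not [ i ]≔ lookup (x [ j ]%= not) j)
      ≡⟨ cong (λ b → f (x [ j ]%= not [ i ]≔ b)) (lookup∘updateAt j x) ⟩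
    f (x [ j ]%= not [ i ]≔ not (lookup x j))
      ≡⟨ cong f (updateAt-updateAt i (x [ j ]%= not)) ⟨
    f (x [ j ]%= not [ i ]≔ lookup x j [ i ]%= not)
      ≡⟨ f-flip _ i ⟩
    not (f (x [ j ]%= not [ i ]≔ lookup x j))
      ≡⟨ cong (not ∘ f) (updateAt-commutes i j i≢j x) ⟩
    not (f (x [ i ]≔ lookup x j [ j ]%= not))
      ≡⟨ cong not (f-flip _ j) ⟩
    not (not ((f ⟨ i ← j ⟩) x))
      ≡⟨ not-involutive _ ⟩
    (f ⟨ i ← j ⟩) x ∎))

  Ess-minor : ∀ {i j} → i ≢ j → Ess (f ⟨ i ← j ⟩) ≡ ⊤ [ i ]≔ outside [ j ]≔ outside
  Ess-minor {i} {j} i≢j = Ess-unique g _ at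
    where
    g = f ⟨ i ← j ⟩
    at : ∀ k → does (essential? g k) ≡ lookup (⊤ [ i ]≔ outside [ j ]≔ outside) k
    at k with k Fin.≟ j
    ... | yes refl = trans (dec-false (essential? g k) (¬essential-minor-j i≢j))
                       (sym (lookup∘update k (⊤ [ i ]≔ outside) outside))
    ... | no k≢j with k Fin.≟ i
    ...   | yes refl = trans (dec-false (essential? g k) (¬essential-minor-i i≢j))
                         (sym (trans (lookup∘update′ k≢j (⊤ [ k ]≔ outside) outside) (lookup∘update k ⊤ outside)))
    ...   | no k≢i = trans (dec-true (essential? g k) (essential-minor k≢i k≢j))
                       (sym (trans (lookup∘update′ k≢j (⊤ [ i ]≔ outside) outside)
                         (trans (lookup∘update′ k≢i ⊤ outside) (lookup-replicate k inside))))

  ess-minor : ∀ {i j} → i ≢ j → suc (suc (ess (f ⟨ i ← j ⟩))) ≡ n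
  ess-minor {i} {j} i≢j = begin
    suc (suc (ess (f ⟨ i ← j ⟩)))                     ≡⟨ cong (λ p → suc (suc ∣ p ∣)) (Ess-minor i≢j) ⟩
    suc (suc ∣ ⊤ [ i ]≔ outside [ j ]≔ outside ∣)     ≡⟨ cong suc (∣p[i]≔outside∣ (⊤ [ i ]≔ outside) j∈) ⟩
    suc ∣ ⊤ [ i ]≔ outside ∣                          ≡⟨ ∣p[i]≔outside∣ ⊤ {i} ∈⊤ ⟩
    ∣ ⊤ {n} ∣                                         ≡⟨ ∣⊤∣≡n n ⟩
    n                                                 ∎
    where
    j∈ : j ∈ ⊤ [ i ]≔ outside
    j∈ = lookup⇒[]= j _ (trans (lookup∘update′ (≢-sym i≢j) ⊤ outside) (lookup-replicate j inside))

  m = n ∸ 2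
  ess-f : ess f ≡ suc (suc m)
  ess-f = ess-full f essential
  ess-minor′ : ∀ {i j} → i ≢ j → ess (f ⟨ i ← j ⟩) ≡ m
  ess-minor′ i≢j = suc-injective (suc-injective (ess-minor i≢j))

  max-minors : max 0 minors ≡ m
  -- All minors have m essential variables; the pair (0 , 1) attains the maximum, and the default 0
  -- is at most m.
  max-minors = max≈v⁺
    (subst (L._∈ minors) (ess-minor′ 0≢1) (∈-map⁺ _ (∈essentialPairs essential 0≢1)))
    (All.map⁺ (All.tabulate λ ij∈ →
      ≤-reflexive (ess-minor′ (essentialPairs-distinct f ij∈))))
    z≤n
    where
    0≢1 : Fin.zero {suc m} ≢ suc zero
    0≢1 ()

-- The canonical disjunctive form

-- `⨁[ S ]monomial x` is definitionally the case of the summand `λ α → monomial α x`; a free summand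
-- lets a filter become a factor and the first entry be split off.
⨁ : ∀ {A : Set} → (A → Bool) → List A → Bool
⨁ h xs = foldr _xor_ false (map h xs)

module _ {A : Set} where

  ⨁-cong : ∀ {g h : A → Bool} → g ≗ h → ∀ xs → ⨁ g xs ≡ ⨁ h xs
  ⨁-cong g≗h xs = cong (foldr _xor_ false) (map-cong g≗h xs)

  ⨁-++ : ∀ (h : A → Bool) xs ys → ⨁ h (xs ++ ys) ≡ ⨁ h xs xor ⨁ h ys
  ⨁-++ h []       ys = refl
  ⨁-++ h (x ∷ xs) ys = trans (cong (h x xor_) (⨁-++ h xs ys)) (sym (xor-assoc (h x) _ _))

  ⨁-map : ∀ {C : Set} (h : A → Bool) (g : C → A) xs → ⨁ h (map g xs) ≡ ⨁ (h ∘ g) xs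
  ⨁-map h g xs = cong (foldr _xor_ false) (sym (map-∘ xs))

  ⨁-zero : ∀ (xs : List A) → ⨁ (λ _ → false) xs ≡ false
  ⨁-zero []       = refl
  ⨁-zero (x ∷ xs) = ⨁-zero xs

  ⨁-filter : ∀ {P : A → Set} (P? : Decidable P) (h : A → Bool) xs →
    ⨁ h (filter P? xs) ≡ ⨁ (λ α → does (P? α) ∧ h α) xs
  ⨁-filter P? h [] = refl
  ⨁-filter P? h (x ∷ xs) with does (P? x)
  ... | true  = cong (h x xor_) (⨁-filter P? h xs)
  ... | false = ⨁-filter P? h xs

-- At x only the monomial with α = x is nonzero. Once the first entry is split off, the half whose
-- entry differs from that of x carries a factor false.
⨁-points : ∀ (h : P₂ n) x → ⨁ (λ α → h α ∧ monomial α x) (points n) ≡ h x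
⨁-points h [] = trans (xor-identityʳ _) (∧-identityʳ _)
⨁-points {suc n} h (a ∷ x) = begin
  ⨁ t (map (false ∷_) (points n) ++ map (true ∷_) (points n) ++ [])
    ≡⟨ ⨁-++ t (map (false ∷_) (points n)) _ ⟩
  ⨁ t (map (false ∷_) (points n)) xor ⨁ t (map (true ∷_) (points n) ++ [])
    ≡⟨ cong (λ zs → ⨁ t (map (false ∷_) (points n)) xor ⨁ t zs) (++-identityʳ (map (true ∷_) (points n))) ⟩
  ⨁ t (map (false ∷_) (points n)) xor ⨁ t (map (true ∷_) (points n))
    ≡⟨ cong₂ _xor_ (⨁-map t _ (points n)) (⨁-map t _ (points n)) ⟩
  ⨁ (t ∘ (false ∷_)) (points n) xor ⨁ (t ∘ (true ∷_)) (points n)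
    ≡⟨ halves a ⟩
  h (a ∷ x) ∎
  where
  open ≡-Reasoning
  t : B^ (suc n) → Bool
  t α = h α ∧ monomial α (a ∷ x)
  vanishes : ∀ b → ⨁ (λ α → h (b ∷ α) ∧ false) (points n) ≡ false
  vanishes b = trans (⨁-cong (λ α → ∧-zeroʳ (h (b ∷ α))) (points n)) (⨁-zero (points n))
  halves : ∀ a → ⨁ (λ α → h (false ∷ α) ∧ monomial (false ∷ α) (a ∷ x)) (points n)
             xor ⨁ (λ α → h (true ∷ α) ∧ monomial (true ∷ α) (a ∷ x)) (points n)
             ≡ h (a ∷ x)
  halves false = trans (cong₂ _xor_ (⨁-points (h ∘ (false ∷_)) x) (vanishes true)) (xor-identityʳ _)
  halves true  = cong₂ _xor_ (vanishes false) (⨁-points (h ∘ (true ∷_)) x)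

-- `Od₂ n` and `Ev₂ n` are the cases c = true and c = false. The filter, turned into a factor, is
-- the function that the sum over all points expands.
parity-form : ∀ c (x : B^ n) →
  ⨁[ filter (λ α → ⊕-coords α ≟ c) (points n) ]monomial x ≡ does (⊕-coords x ≟ c)
parity-form {n} c x = trans
  (⨁-filter (λ α → ⊕-coords α ≟ c) (λ α → monomial α x) (points n))
  (⨁-points (λ α → does (⊕-coords α ≟ c)) x)

-- Gap 2 and the two parity functions.

parity-gap : 2 ≤ n → (f : P₂ n) → (∀ i → Essential f i) →
  ∀ c → f ≗ ⨁[ filter (λ α → ⊕-coords α ≟ c) (points n) ]monomial → gap f ≡ 2
parity-gap 2≤n f essential c f≗ = flipping⇒gap≡2 2≤n f essential λ x k → begin
  f (x [ k ]%= not)                          ≡⟨ f-parity _ ⟩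
  does (⊕-coords (x [ k ]%= not) ≟ c)        ≡⟨ cong (λ b → does (b ≟ c)) (⊕-coords-flip x k) ⟩
  does (not (⊕-coords x) ≟ c)                ≡⟨ not-≟ (⊕-coords x) c ⟩
  not (does (⊕-coords x ≟ c))                ≡⟨ cong not (f-parity x) ⟨
  not (f x)                                  ∎
  where
  open ≡-Reasoning
  f-parity : ∀ x → f x ≡ does (⊕-coords x ≟ c)
  f-parity x = trans (f≗ x) (parity-form c x)
  not-≟ : ∀ b c → does (not b ≟ c) ≡ not (does (b ≟ c))
  not-≟ false false = refl
  not-≟ false true  = refl
  not-≟ true  false = refl
  not-≟ true  true  = refl

gap-parity : 4 ≤ n → (f : P₂ n) → (∀ i → Essential f i) → gap f ≡ 2 →
  ∃ λ c → f ≗ ⨁[ filter (λ α → ⊕-coords α ≟ c) (points n) ]monomial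
-- The value of f is h of the parity, and h differs at the two bits, so the parity class on which f
-- is true is `h true`.
gap-parity {suc n} 4≤n f essential gap≡2 = h true , λ x →
  trans (by-parity x) (trans (h-≟ (h true) (h false) refl refl (⊕-coords x)) (sym (parity-form (h true) x)))
  where
  open Lossy 4≤n f essential (gap≡2⇒lossy f essential gap≡2)
  h : Bool → Bool
  h b = f (b ∷ replicate n false)
  by-parity : ∀ x → f x ≡ h (⊕-coords x)
  by-parity (a ∷ v) = parity-normal-form f flip a v
    where
    flip : ∀ a v i b → f (a ∷ v [ i ]≔ b) ≡ f (not a ∷ v [ i ]≔ not b)
    flip a v i b = flip-two {zero} {suc i} (λ ()) (a ∷ v) a b
  -- Equal values would make f constant, against the essentiality of the first variable.
  ¬constant : h true ≢ h false
  ¬constant eq with essential zero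
  ... | x , ne = ne (trans (by-parity x) (trans (const _ _) (sym (by-parity (x [ zero ]%= not)))))
    where
    const : ∀ b c → h b ≡ h c
    const false false = refl
    const false true  = sym eq
    const true  false = eq
    const true  true  = refl
  h-≟ : ∀ c d → h true ≡ c → h false ≡ d → ∀ b → h b ≡ does (b ≟ c)
  h-≟ c d ht hf true with c
  ... | true  = ht
  ... | false = ht
  h-≟ c d ht hf false with c | d
  ... | true  | false = hf
  ... | false | true  = hf
  ... | true  | true  = contradiction (trans ht (sym hf)) ¬constant
  ... | false | false = contradiction (trans ht (sym hf)) ¬constant

theorem3p4 : (n : ℕ) → 4 ≤ n → (f : P₂ n) → (∀ i → Essential f i) →
    gap f ≡ 2 ⇔ (f ≗ ⨁[ Od₂ n ]monomial ⊎ f ≗ ⨁[ Ev₂ n ]monomial)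
theorem3p4 n 4≤n f essential = mk⇔ to from
  where
  to : gap f ≡ 2 → f ≗ ⨁[ Od₂ n ]monomial ⊎ f ≗ ⨁[ Ev₂ n ]monomial
  to gap≡2 with gap-parity 4≤n f essential gap≡2
  ... | true  , f≗ = inj₁ f≗
  ... | false , f≗ = inj₂ f≗
  2≤n : 2 ≤ n
  2≤n = ≤-trans (s≤s (s≤s z≤n)) 4≤n
  from : f ≗ ⨁[ Od₂ n ]monomial ⊎ f ≗ ⨁[ Ev₂ n ]monomial → gap f ≡ 2
  from (inj₁ f≗) = parity-gap 2≤n f essential true f≗
  from (inj₂ f≗) = parity-gap 2≤n f essential false f≗
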